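{- Let $n\ge 1$ be an integer. If a formula $\vartheta_n\in\mathrm{ML}$ separates the classes $\mathbb{A}_n$ and $\mathbb{B}_n$, then $\mathrm{s}(\vartheta_n)\ge\mathrm{twr}(n-1)$.
   Context: The function $\mathrm{twr}:\mathbb{N}\to\mathbb{N}$ is given by $\mathrm{twr}(0)=1$, $\mathrm{twr}(n+1)=2^{\mathrm{twr}(n)}$. The set of proposition symbols is empty. A pointed frame is a pair $(\mathcal{M},w)$ where $\mathcal{M}=(W,R)$ with $R\subseteq W\times W$ and $w\in W$. Write $\Box(\mathcal{M},w)=\{(\mathcal{M},v)\mid wR^{\mathcal{M}}v\}$. Formulas of $\mathrm{ML}$ are generated by $\varphi:=\top\mid\bot\mid(\varphi\wedge\varphi)\mid(\varphi\vee\varphi)\mid\Diamond\varphi\mid\Box\varphi$ with the usual Kripke semantics. The size $\mathrm{s}(\varphi)$ is the total number of occurrences of modal operators and binary connectives: $\mathrm{s}(\top)=\mathrm{s}(\bot)=0$, $\mathrm{s}(\psi\vee\vartheta)=\mathrm{s}(\psi\wedge\vartheta)=\mathrm{s}(\psi)+\mathrm{s}(\vartheta)+1$, $\mathrm{s}(\Diamond\psi)=\mathrm{s}(\Box\psi)=\mathrm{s}(\psi)+1$. A formula separates $\mathbb{A}$ and $\mathbb{B}$ if every element of $\mathbb{A}$ satisfies it and no element of $\mathbb{B}$ satisfies it. $(\mathcal{M},w)$ and $(\mathcal{M}',w')$ are $n$-bisimilar if there are binary relations $Z_n\subseteq\dots\subseteq Z_0$ between points of $\mathcal{M}$ and points of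 $\mathcal{M}'$ such that $wZ_nw'$ and for every $0\le i\le n-1$: if $vZ_{i+1}v'$ and $vR^{\mathcal{M}}u$ then there is $u'$ with $v'R^{\mathcal{M}'}u'$ and $uZ_iu'$; and if $vZ_{i+1}v'$ and $v'R^{\mathcal{M}'}u'$ then there is $u$ with $vR^{\mathcal{M}}u$ and $uZ_iu'$. $\mathbb{A}_n$ is the class of all pointed frames $(\mathcal{A},w)$ such that for all $(\mathcal{A},u),(\mathcal{A},v)\in\Box(\mathcal{A},w)$ the pointed frames $(\mathcal{A},u)$ and $(\mathcal{A},v)$ are $n$-bisimilar; $\mathbb{B}_n$ is the complement of $\mathbb{A}_n$ in the class of all pointed frames. -}

module Defs where

open import Level using (0ℓ) renaming (suc to lsuc)
open import Data.Empty using (⊥)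
open import Data.Fin using (Fin; zero; suc; inject₁; fromℕ)
open import Data.Nat using (ℕ; zero; suc; _+_; _^_)
open import Data.Product using (_×_; ∃-syntax)
open import Data.Sum using (_⊎_)
open import Data.Unit using (⊤)
open import Relation.Binary.Core using (Rel; REL; _⇒_)
open import Relation.Nullary using (¬_)
open import Relation.Unary using (Pred; _∈_; ∁)

twr : ℕ → ℕ
twr zero    = 1
twr (suc n) = 2 ^ twr n

record Frame : Set₁ where
  field
    W : Set
    R : Rel W 0ℓ

open Frame public

record PointedFrame : Set₁ where
  constructor _,_
  field
    frame : Frame
    point : W frame

infix  9 ◇_ □_
infixr 7 _∧_
infixr 6 _∨_

data ML : Set where
  ⊤′ ⊥′   : ML
  _∧_ _∨_ : ML → ML → ML
  ◇_ □_   : ML → ML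

size : ML → ℕ
size ⊤′      = 0
size ⊥′      = 0
size (φ ∧ ψ) = size φ + size ψ + 1
size (φ ∨ ψ) = size φ + size ψ + 1
size (◇ φ)   = size φ + 1
size (□ φ)   = size φ + 1

infix 4 _⊨_

_⊨_ : PointedFrame → ML → Set
_       ⊨ ⊤′    = ⊤
_       ⊨ ⊥′    = ⊥
(M , w) ⊨ φ ∧ ψ = ((M , w) ⊨ φ) × ((M , w) ⊨ ψ)
(M , w) ⊨ φ ∨ ψ = ((M , w) ⊨ φ) ⊎ ((M , w) ⊨ ψ)
(M , w) ⊨ ◇ φ   = ∃[ v ] R M w v × ((M , v) ⊨ φ)
(M , w) ⊨ □ φ   = ∀ v → R M w v → (M , v) ⊨ φ

-- Z (inject₁ i) and Z (suc i) are the relations Zᵢ and Zᵢ₊₁ for 0 ≤ i ≤ n - 1.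
-- There are no proposition symbols, so Z₀ need not satisfy any atomic condition.
record Bisimilar (n : ℕ) (P P′ : PointedFrame) : Set₁ where
  open PointedFrame P  renaming (frame to M;  point to w)
  open PointedFrame P′ renaming (frame to M′; point to w′)
  field
    Z      : Fin (suc n) → REL (W M) (W M′) 0ℓ
    nested : ∀ (i : Fin n) → Z (suc i) ⇒ Z (inject₁ i)
    start  : Z (fromℕ n) w w′
    forth  : ∀ (i : Fin n) {v v′ u} → Z (suc i) v v′ → R M v u →
             ∃[ u′ ] R M′ v′ u′ × Z (inject₁ i) u u′
    back   : ∀ (i : Fin n) {v v′ u′} → Z (suc i) v v′ → R M′ v′ u′ →
             ∃[ u ] R M v u × Z (inject₁ i) u u′

𝔸 : ℕ → Pred PointedFrame (lsuc 0ℓ)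
𝔸 n (A , w) = ∀ u v → R A w u → R A w v → Bisimilar n (A , u) (A , v)

𝔹 : ℕ → Pred PointedFrame (lsuc 0ℓ)
𝔹 n = ∁ (𝔸 n)

Separates : ML → (P Q : Pred PointedFrame (lsuc 0ℓ)) → Set₁
Separates φ P Q = (∀ x → x ∈ P → x ⊨ φ) × (∀ x → x ∈ Q → ¬ (x ⊨ φ))

{-# OPTIONS --safe #-}

-- There are twr n hereditarily finite sets of rank at most n, and no two of
-- them are n-bisimilar. A root whose only successor is x lies in 𝔸 n, while a
-- root with two distinct successors x and y lies in 𝔹 n. A formula θ true at
-- the first root but not at the second must have an outermost subformula □ ψ
-- with ψ true at x and false at y, since an outermost ◇ ψ true at the first
-- root remains true at the second. So the outermost boxes of θ, k in number,
-- tell all twr n sets apart, whence 2 ^ twr (n − 1) = twr n ≤ 2 ^ k.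
module Submission where

open import Defs
open import Data.Nat using (ℕ; _≤_; _∸_)

open import Data.Empty using (⊥-elim)
open import Data.Fin using (Fin; zero; suc; toℕ; fromℕ; inject₁; combine; finToFun; funToFin)
open import Data.Fin.Properties
  using (_≟_; any?; all?; pigeonhole; <⇒≢; toℕ-fromℕ; toℕ-inject₁;
         finToFun-funToFin; funToFin-finToFin)
open import Data.List using (List; []; _∷_; _++_; length; lookup)
open import Data.List.Properties using (length-++)
open import Data.List.Relation.Unary.All using (All; []; _∷_)
open import Data.List.Relation.Unary.All.Properties using (++⁻ˡ; ++⁻ʳ)
open import Data.Nat using (zero; suc; _+_; _^_; _<_; z≤n; s≤s)
open import Data.Nat.Properties
  using (≤-trans; ≤-<-trans; ≤-reflexive; m≤m+n; m≤n+m; +-mono-≤; ^-monoʳ-<; ≮⇒≥; suc-injective)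
open import Data.Product using (_×_; _,_; ∃-syntax)
open import Data.Sum using (inj₁; inj₂)
open import Data.Unit using (tt)
open import Level using (0ℓ)
open import Relation.Binary.Core using (Rel)
open import Relation.Binary.PropositionalEquality
  using (_≡_; _≢_; refl; sym; trans; cong; cong₂)
open import Relation.Nullary using (Dec; yes; no)
open import Relation.Nullary.Decidable using (_×-dec_; _⊎-dec_; _→-dec_; map′)

-- A record, since n cannot be inferred from Fin (twr n).
record Code (n : ℕ) : Set where
  constructor code
  field index : Fin (twr n)

-- A code of rank suc n is the characteristic function of a set of codes of rank n.
_∋_ : ∀ {n} → Code (suc n) → Code n → Set
_∋_ {n} (code i) (code j) = finToFun {2} {twr n} i j ≡ suc zero

_∋?_ : ∀ {n} (x : Code (suc n)) (y : Code n) → Dec (x ∋ y)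
_∋?_ {n} (code i) (code j) = finToFun {2} {twr n} i j ≟ suc zero

Fin2-ext : (a b : Fin 2) → (a ≡ suc zero → b ≡ suc zero) →
           (b ≡ suc zero → a ≡ suc zero) → a ≡ b
Fin2-ext zero       zero       _ _ = refl
Fin2-ext zero       (suc zero) _ g = g refl
Fin2-ext (suc zero) zero       f _ = sym (f refl)
Fin2-ext (suc zero) (suc zero) _ _ = refl

funToFin-cong : ∀ {m n} {f g : Fin m → Fin n} → (∀ i → f i ≡ g i) → funToFin f ≡ funToFin g
funToFin-cong {zero}  eq = refl
funToFin-cong {suc m} eq = cong₂ combine (eq zero) (funToFin-cong λ i → eq (suc i))

finToFun-injective : ∀ m n {x y : Fin (m ^ n)} →
                     (∀ i → finToFun {m} {n} x i ≡ finToFun y i) → x ≡ y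
finToFun-injective m n {x} {y} eq =
  trans (sym (funToFin-finToFin {n} {m} x))
        (trans (funToFin-cong eq) (funToFin-finToFin {n} {m} y))

∋-extensional : ∀ {n} {x y : Code (suc n)} →
                (∀ z → x ∋ z → y ∋ z) → (∀ z → y ∋ z → x ∋ z) → x ≡ y
∋-extensional {n} {code i} {code j} f g = cong code (finToFun-injective 2 (twr n) λ k →
  Fin2-ext (finToFun i k) (finToFun j k) (f (code k)) (g (code k)))

data Point : Set where
  set  : ∀ n → Code n → Point
  root : ∀ n → Code n → Code n → Point

-- Every edge between sets lowers the level by exactly one, so a set occurs as a separate point at
-- each level from its rank upwards. Roots live in the same frame, which lets one frame serve for
-- all pairs.
data _⟶_ : Rel Point 0ℓ where
  member : ∀ {n} {x : Code (suc n)} {y} → x ∋ y → set (suc n) x ⟶ set n y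
  left   : ∀ {n x y} → root n x y ⟶ set n x
  right  : ∀ {n x y} → root n x y ⟶ set n y

𝓕 : Frame
𝓕 = record { W = Point ; R = _⟶_ }

at : Point → PointedFrame
at p = 𝓕 , p

bisimilar-refl : ∀ n P → Bisimilar n P P
bisimilar-refl n P = record
  { Z      = λ _ → _≡_
  ; nested = λ _ eq → eq
  ; start  = refl
  ; forth  = λ { _ refl r → _ , r , refl }
  ; back   = λ { _ refl r → _ , r , refl }
  }

-- Induction on the level: `forth` and `back` match the members of the two sets, matched members are
-- equal by induction, and extensionality concludes.
bisimilar⇒≡ : ∀ n {x y : Code n} → Bisimilar n (at (set n x)) (at (set n y)) → x ≡ y
bisimilar⇒≡ n B = go (fromℕ n) n (toℕ-fromℕ n) start
  where
  open Bisimilar B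

  -- The index of the relation and the level of the sets fall together; an equation ties them
  -- because `inject₁ i` and `suc i` live in the same `Fin (suc n)`.
  go : ∀ (i : Fin (suc n)) m {x y : Code m} → toℕ i ≡ m →
       Z i (set m x) (set m y) → x ≡ y
  go i zero {code zero} {code zero} _ _ = refl
  go (suc i) (suc m) {x} {y} eq z = ∋-extensional x⊆y y⊆x
    where
    eq′ : toℕ (inject₁ i) ≡ m
    eq′ = trans (toℕ-inject₁ i) (suc-injective eq)

    x⊆y : ∀ u → x ∋ u → y ∋ u
    x⊆y u x∋u with forth i z (member x∋u)
    ... | _ , member y∋v , z′ with refl ← go (inject₁ i) m eq′ z′ = y∋v

    y⊆x : ∀ u → y ∋ u → x ∋ u
    y⊆x u y∋u with back i z (member y∋u)
    ... | _ , member x∋v , z′ with refl ← go (inject₁ i) m eq′ z′ = x∋v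

root∈𝔸 : ∀ n x → 𝔸 n (at (root n x x))
root∈𝔸 n x _ _ left  left  = bisimilar-refl n _
root∈𝔸 n x _ _ left  right = bisimilar-refl n _
root∈𝔸 n x _ _ right left  = bisimilar-refl n _
root∈𝔸 n x _ _ right right = bisimilar-refl n _

root∈𝔹 : ∀ n {x y} → x ≢ y → 𝔹 n (at (root n x y))
root∈𝔹 n x≢y P∈𝔸 = x≢y (bisimilar⇒≡ n (P∈𝔸 _ _ left right))

-- Modalities at a set range over finitely many codes. Decidability turns truth values into bits
-- that the pigeonhole principle can count.
⊨? : ∀ φ n (x : Code n) → Dec (at (set n x) ⊨ φ)
⊨? ⊤′      n       x = yes tt
⊨? ⊥′      n       x = no λ ()
⊨? (φ ∧ ψ) n       x = ⊨? φ n x ×-dec ⊨? ψ n x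
⊨? (φ ∨ ψ) n       x = ⊨? φ n x ⊎-dec ⊨? ψ n x
⊨? (◇ φ)   zero    x = no λ { (_ , () , _) }
⊨? (◇ φ)   (suc n) x =
  map′ (λ { (j , x∋j , s) → set n (code j) , member x∋j , s })
       (λ { (_ , member x∋y , s) → _ , x∋y , s })
       (any? λ j → (x ∋? code j) ×-dec ⊨? φ n (code j))
⊨? (□ φ)   zero    x = yes λ _ ()
⊨? (□ φ)   (suc n) x =
  map′ (λ { h _ (member x∋y) → h _ x∋y })
       (λ h j x∋j → h (set n (code j)) (member x∋j))
       (all? λ j → (x ∋? code j) →-dec ⊨? φ n (code j))

boxed : ML → List ML
boxed ⊤′      = []
boxed ⊥′      = []
boxed (φ ∧ ψ) = boxed φ ++ boxed ψ
boxed (φ ∨ ψ) = boxed φ ++ boxed ψ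
boxed (◇ φ)   = []
boxed (□ φ)   = φ ∷ []

length-boxed≤size : ∀ φ → length (boxed φ) ≤ size φ
length-boxed-++≤size : ∀ φ ψ → length (boxed φ ++ boxed ψ) ≤ size φ + size ψ + 1

length-boxed≤size ⊤′      = z≤n
length-boxed≤size ⊥′      = z≤n
length-boxed≤size (φ ∧ ψ) = length-boxed-++≤size φ ψ
length-boxed≤size (φ ∨ ψ) = length-boxed-++≤size φ ψ
length-boxed≤size (◇ φ)   = z≤n
length-boxed≤size (□ φ)   = m≤n+m 1 (size φ)

length-boxed-++≤size φ ψ =
  ≤-trans (≤-reflexive (length-++ (boxed φ)))
          (≤-trans (+-mono-≤ (length-boxed≤size φ) (length-boxed≤size ψ))
                   (m≤m+n _ 1))

_⊑[_]_ : ∀ {n} → Code n → List ML → Code n → Set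
_⊑[_]_ {n} x Γ y = All (λ ψ → at (set n x) ⊨ ψ → at (set n y) ⊨ ψ) Γ

-- The second root keeps the successor `x` and gains `y`. Conjunction and disjunction are monotone,
-- so only an outermost box can fail, and its body passes from `x` to `y` by assumption.
root-transfer : ∀ φ {n} {x y : Code n} → x ⊑[ boxed φ ] y →
                at (root n x x) ⊨ φ → at (root n x y) ⊨ φ
root-transfer ⊤′      _       _                = tt
root-transfer (φ ∧ ψ) t       (s , s′)         =
  root-transfer φ (++⁻ˡ _ t) s , root-transfer ψ (++⁻ʳ (boxed φ) t) s′
root-transfer (φ ∨ ψ) t       (inj₁ s)         = inj₁ (root-transfer φ (++⁻ˡ _ t) s)
root-transfer (φ ∨ ψ) t       (inj₂ s)         = inj₂ (root-transfer ψ (++⁻ʳ (boxed φ) t) s)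
root-transfer (◇ φ)   _       (_ , left  , s)  = _ , left , s
-- In `root n x x` the right successor is also `x`, which is the left successor of `root n x y`.
root-transfer (◇ φ)   _       (_ , right , s)  = _ , left , s
root-transfer (□ φ)   _       s _ left         = s _ left
root-transfer (□ φ)   (t ∷ _) s _ right        = t (s _ left)

bit : ∀ {P : Set} → Dec P → Fin 2
bit (yes _) = suc zero
bit (no _)  = zero

bit-≡⇒→ : ∀ {P Q : Set} (p? : Dec P) (q? : Dec Q) → bit p? ≡ bit q? → P → Q
bit-≡⇒→ _       (yes q) _  _ = q
bit-≡⇒→ (no ¬p) (no _)  _  p = ⊥-elim (¬p p)
bit-≡⇒→ (yes _) (no _)  () _

truthValues : ∀ (Γ : List ML) n → Code n → Fin (length Γ) → Fin 2
truthValues Γ n x i = bit (⊨? (lookup Γ i) n x)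

truthValues-≗⇒⊑ : ∀ Γ {n} {x y : Code n} →
                  (∀ i → truthValues Γ n x i ≡ truthValues Γ n y i) → x ⊑[ Γ ] y
truthValues-≗⇒⊑ []      eq = []
truthValues-≗⇒⊑ (ψ ∷ Γ) eq =
  bit-≡⇒→ (⊨? ψ _ _) (⊨? ψ _ _) (eq zero) ∷ truthValues-≗⇒⊑ Γ λ i → eq (suc i)

-- There are only `2 ^ length Γ` vectors of truth values, so two distinct codes share one.
indistinguishable : ∀ Γ n → 2 ^ length Γ < twr n →
                    ∃[ x ] ∃[ y ] x ≢ y × _⊑[_]_ {n} x Γ y
indistinguishable Γ n few
  with i , j , i<j , eq ← pigeonhole few (λ i → funToFin (truthValues Γ n (code i))) =
  code i , code j , (λ eq′ → <⇒≢ i<j (cong Code.index eq′)) , truthValues-≗⇒⊑ Γ λ k →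
    trans (sym (finToFun-funToFin (truthValues Γ n (code i)) k))
          (trans (cong (λ c → finToFun {2} {length Γ} c k) eq)
                 (finToFun-funToFin (truthValues Γ n (code j)) k))

theorem4p11 : (n : ℕ) → 1 ≤ n → (θ : ML) → Separates θ (𝔸 n) (𝔹 n) → twr (n ∸ 1) ≤ size θ
theorem4p11 (suc m) _ θ (⊨𝔸 , ⊭𝔹) = ≮⇒≥ λ small →
  -- Exponentiating `length (boxed θ) < twr m` gives the bound for pigeonhole, as `twr (suc m)` is
  -- `2 ^ twr m`.
  let few = ^-monoʳ-< 2 (s≤s (s≤s z≤n)) (≤-<-trans (length-boxed≤size θ) small)
      x , y , x≢y , x⊑y = indistinguishable (boxed θ) (suc m) few
  in ⊭𝔹 _ (root∈𝔹 (suc m) x≢y) (root-transfer θ x⊑y (⊨𝔸 _ (root∈𝔸 (suc m) x)))
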